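{- Let a group $G$ act on a set $U$, and let $\mathcal{F}$ be a $G$-invariant family of finite subsets of $U$ whose cardinalities are uniformly bounded, i.e. $\max_{F\in\mathcal{F}}|F|<\infty$. Let $X\subseteq U$ be a finite system of representatives for $\mathcal{F}$, i.e. $X\cap F\neq\emptyset$ for every $F\in\mathcal{F}$. Then there exists a $G$-invariant system of representatives $Y\subseteq U$ for $\mathcal{F}$ (i.e. $gY=Y$ for all $g\in G$ and $Y\cap F\neq\emptyset$ for all $F\in\mathcal{F}$) such that $|Y|\le |X|\cdot\max_{F\in\mathcal{F}}|F|$.
   Context: A family $\mathcal{F}$ here is an unordered family, i.e. a set of subsets of $U$. It is $G$-invariant if $gF=\{gf\mid f\in F\}\in\mathcal{F}$ for all $g\in G$ and $F\in\mathcal{F}$. -}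

module Defs where

open import Algebra.Bundles using (Group)
open import Data.List.Base using (List; length)
open import Data.List.Membership.Propositional using () renaming (_∈_ to _∈ˡ_)
open import Data.List.Relation.Unary.Unique.Propositional using (Unique)
open import Data.Nat.Base using (ℕ; _≤_)
open import Data.Product.Base using (Σ; ∃; ∃-syntax; _×_; _,_)
open import Data.Sum.Base using (_⊎_)
open import Function.Bundles using (_⇔_)
open import Level using (Level; _⊔_; suc)
open import Relation.Binary.Definitions using (_Respects_)
open import Relation.Binary.PropositionalEquality.Core using (_≡_)
open import Relation.Nullary.Negation.Core using (¬_)
open import Relation.Unary using (Pred; _∈_; _≐_; _≬_)

private variable
  c ℓ u f p : Level

record Action (G : Group c ℓ) (U : Set u) : Set (c ⊔ ℓ ⊔ u) where
  open Group G using (Carrier; _≈_; _∙_; ε)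
  infixr 8 _·_ _·ˢ_
  field
    _·_    : Carrier → U → U
    ·-cong : ∀ {g h} → g ≈ h → ∀ x → g · x ≡ h · x
    ε-act  : ∀ x → ε · x ≡ x
    ∙-act  : ∀ g h x → (g ∙ h) · x ≡ g · (h · x)

  _·ˢ_ : Carrier → Pred U u → Pred U u
  (g ·ˢ F) x = ∃[ y ] (y ∈ F × x ≡ g · y)

  InvariantSubset : Pred U u → Set (c ⊔ u)
  InvariantSubset Y = ∀ g → g ·ˢ Y ≐ Y

  InvariantFamily : Pred (Pred U u) f → Set (c ⊔ suc u ⊔ f)
  InvariantFamily 𝓕 = ∀ g F → F ∈ 𝓕 → (g ·ˢ F) ∈ 𝓕

-- Subsets are predicates whose proofs of membership need not be unique, so
-- elements are counted by a duplicate-free enumeration in U, not in Σ U S.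
HasCard : {U : Set u} → Pred U p → ℕ → Set (u ⊔ p)
HasCard {U = U} S n =
  Σ (List U) λ xs → Unique xs × length xs ≡ n × (∀ x → x ∈ S ⇔ x ∈ˡ xs)

Finite : {U : Set u} → Pred U p → Set (u ⊔ p)
Finite S = ∃[ n ] HasCard S n

-- A set of subsets: membership in a family may depend only on the elements
-- of a subset, not on the predicate presenting it.
IsFamily : {U : Set u} → Pred (Pred U u) f → Set (suc u ⊔ f)
IsFamily 𝓕 = 𝓕 Respects _≐_

-- For the empty family the maximum is taken to be 0.
IsMaxCard : {U : Set u} → Pred (Pred U u) f → ℕ → Set (suc u ⊔ f)
IsMaxCard 𝓕 m =
  (∀ F k → F ∈ 𝓕 → HasCard F k → k ≤ m) ×
  ((∃[ F ] (F ∈ 𝓕 × HasCard F m)) ⊎ ((∀ F → ¬ (F ∈ 𝓕)) × m ≡ 0))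

IsSystemOfRepresentatives : {U : Set u} → Pred (Pred U u) f → Pred U u → Set (suc u ⊔ f)
IsSystemOfRepresentatives 𝓕 X = ∀ F → F ∈ 𝓕 → X ≬ F

{-# OPTIONS --safe #-}

-- Y is the union of the finite orbits O with |O| ≤ m |X ∩ O|; summing over these orbits gives |Y| ≤ m |X|.
-- That Y meets every F is an averaging argument. For an invariant mean over g, the chance that g f = x is
-- 1 / |G f| for x in G f (and 0 if G f is infinite). Every translate of F meets X, so some f in F satisfies
-- |X ∩ G f| / |G f| ≥ 1 / |F| ≥ 1 / m, and f lies in Y. As G need not be amenable, the mean is replaced by a
-- finite list S of group elements, averaged uniformly: if s is drawn from S, the distributions of the points
-- s f (f in F) have a sum of squared ℓ²-norms which drops by a definite amount when S is replaced by S ++ g S,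
-- unless all these distributions are almost g-invariant; so after finitely many steps they are almost invariant
-- under every g.
module Submission where

open import Defs
open import Algebra.Bundles using (Group)
open import Axiom.ExcludedMiddle using (ExcludedMiddle)
open import Data.Nat.Base using (ℕ; _≤_; _*_)
open import Data.Product.Base using (∃-syntax; _×_)
open import Level using (Level; _⊔_)
open import Relation.Unary using (Pred; _∈_; _≬_)

open import Data.Empty using (⊥-elim)
open import Data.List.Base using (List; []; _∷_; _++_; map; length; filter; deduplicate)
open import Data.List.Membership.Propositional using (find) renaming (_∈_ to _∈ˡ_; _∉_ to _∉ˡ_)
open import Data.List.Membership.Propositional.Properties
  using (∈-map⁻; ∈-++⁺ˡ; ∈-++⁺ʳ; ∈-++⁻; ∈-filter⁻; ∈-deduplicate⁺; ∈-deduplicate⁻)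
open import Data.List.Properties
  using (map-++; map-∘; map-cong; length-++; length-map; length-filter; length-deduplicate
        ; filter-reject; filter-≐)
open import Data.List.Relation.Unary.All as All using ([]; _∷_)
open import Data.List.Relation.Unary.All.Properties using (¬Any⇒All¬)
open import Data.List.Relation.Unary.AllPairs using ([]; _∷_)
open import Data.List.Relation.Unary.Any as Any using (here; there)
open import Data.List.Relation.Unary.Unique.Propositional using (Unique)
import Data.List.Relation.Unary.Unique.DecPropositional.Properties as Uniqueₚ
open import Data.Nat.Base using (zero; suc; _+_; _∸_; _<_; z≤n; s≤s; >-nonZero)
open import Data.Nat.ListAction using (sum)
open import Data.Nat.ListAction.Properties using (sum-++)
open import Data.Nat.Properties
open import Data.Nat.Tactic.RingSolver using (solve-∀)
open import Data.Product.Base using (_,_; proj₂)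
open import Data.Sum.Base using (_⊎_; inj₁; inj₂; [_,_]′)
open import Function.Base using (_∘_)
open import Function.Bundles using (_⇔_; mk⇔; Equivalence)
open import Relation.Binary.Definitions using (DecidableEquality)
open import Relation.Binary.PropositionalEquality
  using (_≡_; _≢_; refl; sym; trans; cong; cong₂; subst; module ≡-Reasoning)
open import Relation.Nullary using (¬_; Dec; yes; no; ¬?; contradiction)

private variable
  i j : Level
  A : Set i
  B : Set j

-- Finite sums over lists.

∑ : (A → ℕ) → List A → ℕ
∑ h xs = sum (map h xs)

∑-++ : ∀ (h : A → ℕ) xs ys → ∑ h (xs ++ ys) ≡ ∑ h xs + ∑ h ys
∑-++ h xs ys = trans (cong sum (map-++ h xs ys)) (sum-++ (map h xs) (map h ys))

∑-map : ∀ (h : B → ℕ) (k : A → B) xs → ∑ h (map k xs) ≡ ∑ (h ∘ k) xs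
∑-map h k xs = cong sum (sym (map-∘ xs))

∑-cong : ∀ {h k : A → ℕ} → (∀ x → h x ≡ k x) → ∀ xs → ∑ h xs ≡ ∑ k xs
∑-cong h≗k xs = cong sum (map-cong h≗k xs)

∑-mono : ∀ {h k : A → ℕ} xs → (∀ x → x ∈ˡ xs → h x ≤ k x) → ∑ h xs ≤ ∑ k xs
∑-mono []       h≤k = z≤n
∑-mono (x ∷ xs) h≤k = +-mono-≤ (h≤k x (here refl)) (∑-mono xs (λ y y∈ → h≤k y (there y∈)))

-- Carries a gain `e` at one entry over to the whole sum; the other entries must merely not lose.
-- This is how the energy drop at a single point reaches `Φ`.
∑-mono-gap : ∀ {h k : A → ℕ} {e x} xs → x ∈ˡ xs → (∀ y → h y ≤ k y) →
             h x + e ≤ k x → ∑ h xs + e ≤ ∑ k xs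
∑-mono-gap {h = h} {k} {e} {x} (_ ∷ xs) (here refl) h≤k gap = begin
  h x + ∑ h xs + e    ≡⟨ rotate (h x) (∑ h xs) e ⟩
  h x + e + ∑ h xs    ≤⟨ +-mono-≤ gap (∑-mono xs (λ y _ → h≤k y)) ⟩
  k x + ∑ k xs        ∎
  where
  open ≤-Reasoning
  rotate : ∀ p q r → p + q + r ≡ p + r + q
  rotate = solve-∀
∑-mono-gap {h = h} {k} {e} (y ∷ xs) (there x∈) h≤k gap = begin
  h y + ∑ h xs + e    ≡⟨ +-assoc (h y) _ e ⟩
  h y + (∑ h xs + e)  ≤⟨ +-mono-≤ (h≤k y) (∑-mono-gap xs x∈ h≤k gap) ⟩
  k y + ∑ k xs        ∎
  where open ≤-Reasoning

∑-distrib-+ : ∀ (h k : A → ℕ) xs → ∑ (λ x → h x + k x) xs ≡ ∑ h xs + ∑ k xs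
∑-distrib-+ h k []       = refl
∑-distrib-+ h k (x ∷ xs) rewrite ∑-distrib-+ h k xs = interchange (h x) (k x) (∑ h xs) (∑ k xs)
  where
  interchange : ∀ p q r s → p + q + (r + s) ≡ p + r + (q + s)
  interchange = solve-∀

*-distribˡ-∑ : ∀ c (h : A → ℕ) xs → c * ∑ h xs ≡ ∑ (λ x → c * h x) xs
*-distribˡ-∑ c h []       = *-zeroʳ c
*-distribˡ-∑ c h (x ∷ xs) = trans (*-distribˡ-+ c (h x) (∑ h xs)) (cong (c * h x +_) (*-distribˡ-∑ c h xs))

∑-const : ∀ c (xs : List A) → ∑ (λ _ → c) xs ≡ length xs * c
∑-const c []       = refl
∑-const c (x ∷ xs) = cong (c +_) (∑-const c xs)

∑-swap : ∀ (h : A → B → ℕ) xs ys →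
         ∑ (λ x → ∑ (h x) ys) xs ≡ ∑ (λ y → ∑ (λ x → h x y) xs) ys
∑-swap h []       ys = sym (trans (∑-const 0 ys) (*-zeroʳ (length ys)))
∑-swap h (x ∷ xs) ys = trans (cong (∑ (h x) ys +_) (∑-swap h xs ys))
                             (sym (∑-distrib-+ (h x) (λ y → ∑ (λ z → h z y) xs) ys))

∈⇒≤∑ : ∀ (h : A → ℕ) {x xs} → x ∈ˡ xs → h x ≤ ∑ h xs
∈⇒≤∑ h (here refl) = m≤m+n _ _
∈⇒≤∑ h (there x∈)  = ≤-trans (∈⇒≤∑ h x∈) (m≤n+m _ _)

∑≡0 : ∀ {h : A → ℕ} xs → (∀ x → x ∈ˡ xs → h x ≡ 0) → ∑ h xs ≡ 0
∑≡0 []       h≡0 = refl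
∑≡0 (x ∷ xs) h≡0 rewrite h≡0 x (here refl) = ∑≡0 xs (λ y y∈ → h≡0 y (there y∈))

∑≤length*max : ∀ {h : A → ℕ} {c} xs → (∀ x → x ∈ˡ xs → h x ≤ c) → ∑ h xs ≤ length xs * c
∑≤length*max {c = c} xs h≤c = ≤-trans (∑-mono xs h≤c) (≤-reflexive (∑-const c xs))

∑-filter : ∀ {p} {P : Pred A p} (P? : ∀ x → Dec (P x)) {h : A → ℕ} xs →
           (∀ x → ¬ P x → h x ≡ 0) → ∑ h (filter P? xs) ≡ ∑ h xs
∑-filter P? []       h≡0 = refl
∑-filter P? {h} (x ∷ xs) h≡0 with P? x
... | yes _  = cong (h x +_) (∑-filter P? xs h≡0)
... | no ¬Px rewrite h≡0 x ¬Px = ∑-filter P? xs h≡0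

-- Some entry carries at least the share N / m of the total, stated without division. If every
-- `m * h x` were below `N`, then m N ≤ m ∑ h < |xs| N ≤ m N.
pigeonhole : ∀ (h : A → ℕ) N m xs → 0 < N → length xs ≤ m → N ≤ ∑ h xs →
             ∃[ x ] (x ∈ˡ xs × N ≤ m * h x)
pigeonhole h N m xs 0<N len≤m N≤∑ with Any.any? (λ x → N ≤? m * h x) xs
... | yes p = find p
... | no ¬p = ⊥-elim (<-irrefl refl (begin-strict
  m * N                       ≤⟨ *-monoʳ-≤ m N≤∑ ⟩
  m * ∑ h xs                  ≡⟨ *-distribˡ-∑ m h xs ⟩
  ∑ (λ x → m * h x) xs        <⟨ below xs xs≢[] (¬Any⇒All¬ xs ¬p) ⟩
  length xs * N               ≤⟨ *-monoˡ-≤ N len≤m ⟩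
  m * N                       ∎))
  where
  open ≤-Reasoning
  -- The strict inequality of sums needs at least one term; an empty list would give `N ≤ 0`.
  xs≢[] : xs ≢ []
  xs≢[] refl = <-irrefl refl (<-≤-trans 0<N N≤∑)
  below : ∀ ys → ys ≢ [] → All.All (λ x → ¬ N ≤ m * h x) ys → ∑ (λ x → m * h x) ys < length ys * N
  below []       ≢[] _        = contradiction refl ≢[]
  below (y ∷ ys) _   (q ∷ qs) = +-mono-<-≤ (≰⇒> q)
    (∑≤length*max ys (λ z z∈ → <⇒≤ (≰⇒> (All.lookup qs z∈))))

-- Over the integers this is the expansion of (a - b)². Truncated subtraction only loses the square
-- when `a ≤ b`, hence an inequality.
2ab+[a∸b]²≤a²+b² : ∀ a b → 2 * (a * b) + (a ∸ b) * (a ∸ b) ≤ a * a + b * b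
2ab+[a∸b]²≤a²+b² a b with ≤-total a b
... | inj₁ a≤b with e , refl ← m≤n⇒∃[o]m+o≡n a≤b rewrite m≤n⇒m∸n≡0 (m≤m+n a e) =
  ≤-trans (m≤m+n _ (e * e)) (≤-reflexive (identity a e))
  where
  identity : ∀ a e → 2 * (a * (a + e)) + 0 + e * e ≡ a * a + (a + e) * (a + e)
  identity = solve-∀
... | inj₂ b≤a with e , refl ← m≤n⇒∃[o]m+o≡n b≤a rewrite m+n∸m≡n b e =
  ≤-reflexive (identity b e)
  where
  identity : ∀ b e → 2 * ((b + e) * b) + e * e ≡ (b + e) * (b + e) + b * b
  identity = solve-∀

-- Multiplicity functions of lists and their inner product.

module Counting {u} {U : Set u} (_≟_ : DecidableEquality U) where

  δ : U → U → ℕ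
  δ x y with x ≟ y
  ... | yes _ = 1
  ... | no  _ = 0

  δ-refl : ∀ x → δ x x ≡ 1
  δ-refl x with x ≟ x
  ... | yes _  = refl
  ... | no x≢x = contradiction refl x≢x

  δ-≢ : ∀ {x y} → x ≢ y → δ x y ≡ 0
  δ-≢ {x} {y} x≢y with x ≟ y
  ... | yes x≡y = contradiction x≡y x≢y
  ... | no _    = refl

  δ-injective : ∀ {h : U → U} → (∀ {x y} → h x ≡ h y → x ≡ y) → ∀ x y → δ (h x) (h y) ≡ δ x y
  δ-injective {h} inj x y with x ≟ y
  ... | yes refl = δ-refl (h x)
  ... | no x≢y   = δ-≢ (x≢y ∘ inj)

  ∑-δ-∉ : ∀ {x xs} (h : U → ℕ) → x ∉ˡ xs → ∑ (λ y → δ x y * h y) xs ≡ 0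
  ∑-δ-∉ {x} {xs} h x∉ = ∑≡0 xs λ y y∈ → cong (_* h y) (δ-≢ {x} {y} λ { refl → x∉ y∈ })

  ∑-δ-∈ : ∀ {x xs} (h : U → ℕ) → Unique xs → x ∈ˡ xs → ∑ (λ y → δ x y * h y) xs ≡ h x
  ∑-δ-∈ {x} h (x≢ ∷ _) (here refl)
    rewrite δ-refl x | ∑-δ-∉ h (λ x∈ → All.lookup x≢ x∈ refl) =
    trans (+-identityʳ _) (+-identityʳ _)
  ∑-δ-∈ {x} {y ∷ _} h (y≢ ∷ !xs) (there x∈)
    rewrite δ-≢ {x} {y} (λ { refl → All.lookup y≢ x∈ refl }) = ∑-δ-∈ h !xs x∈

  count : List U → U → ℕ
  count xs y = ∑ (λ x → δ x y) xs

  count-∉ : ∀ {xs y} → y ∉ˡ xs → count xs y ≡ 0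
  count-∉ {xs} {y} y∉ = ∑≡0 xs λ x x∈ → δ-≢ {x} {y} λ { refl → y∉ x∈ }

  count-map : ∀ {h : U → U} → (∀ {x y} → h x ≡ h y → x ≡ y) →
              ∀ xs y → count (map h xs) (h y) ≡ count xs y
  count-map {h} inj xs y = trans (∑-map _ h xs) (∑-cong (λ x → δ-injective inj x y) xs)

  -- After exchanging the sums, each entry of `xs` is met at most once, because `ys` is free of
  -- duplicates.
  ∑-count≤length : ∀ xs {ys} → Unique ys → ∑ (count xs) ys ≤ length xs
  ∑-count≤length xs {ys} !ys = begin
    ∑ (count xs) ys                ≡⟨ ∑-swap (λ y x → δ x y) ys xs ⟩
    ∑ (λ x → ∑ (δ x) ys) xs        ≤⟨ ∑≤length*max xs (λ x _ → ∑δ≤1 x) ⟩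
    length xs * 1                  ≡⟨ *-identityʳ _ ⟩
    length xs                      ∎
    where
    open ≤-Reasoning
    δ*1 : ∀ x → ∑ (δ x) ys ≡ ∑ (λ y → δ x y * 1) ys
    δ*1 x = ∑-cong (λ y → sym (*-identityʳ (δ x y))) ys
    ∑δ≤1 : ∀ x → ∑ (δ x) ys ≤ 1
    ∑δ≤1 x with Any.any? (x ≟_) ys
    ... | yes x∈ = ≤-reflexive (trans (δ*1 x) (∑-δ-∈ (λ _ → 1) !ys x∈))
    ... | no x∉  = ≤-trans (≤-reflexive (trans (δ*1 x) (∑-δ-∉ (λ _ → 1) x∉))) z≤n

  -- The inner product of the multiplicity functions of two lists.
  ⟪_,_⟫ : List U → List U → ℕ
  ⟪ xs , ys ⟫ = ∑ (count ys) xs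

  -- Groups the entries of `xs` by value. As `zs` may be larger than needed for `xs`, several lists
  -- can be expanded in the same coordinates.
  ∑-by-count : ∀ {xs zs} (h : U → ℕ) → Unique zs → (∀ {x} → x ∈ˡ xs → x ∈ˡ zs) →
               ∑ h xs ≡ ∑ (λ z → count xs z * h z) zs
  ∑-by-count {[]}     {zs} h !zs xs⊆zs = sym (∑≡0 zs (λ _ _ → refl))
  ∑-by-count {x ∷ xs} {zs} h !zs xs⊆zs = begin
    h x + ∑ h xs
      ≡⟨ cong₂ _+_ (sym (∑-δ-∈ h !zs (xs⊆zs (here refl)))) (∑-by-count {xs} h !zs (xs⊆zs ∘ there)) ⟩
    ∑ (λ z → δ x z * h z) zs + ∑ (λ z → count xs z * h z) zs
      ≡⟨ ∑-distrib-+ _ _ zs ⟨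
    ∑ (λ z → δ x z * h z + count xs z * h z) zs
      ≡⟨ ∑-cong (λ z → sym (*-distribʳ-+ (h z) (δ x z) (count xs z))) zs ⟩
    ∑ (λ z → count (x ∷ xs) z * h z) zs
      ∎
    where open ≡-Reasoning

  ⟪⟫-++ : ∀ xs ys → ⟪ xs ++ ys , xs ++ ys ⟫ ≡ ⟪ xs , xs ⟫ + ⟪ xs , ys ⟫ + (⟪ ys , xs ⟫ + ⟪ ys , ys ⟫)
  ⟪⟫-++ xs ys = trans (∑-++ _ xs ys) (cong₂ _+_ (split xs) (split ys))
    where
    split : ∀ zs → ∑ (count (xs ++ ys)) zs ≡ ⟪ zs , xs ⟫ + ⟪ zs , ys ⟫
    split zs = trans (∑-cong (λ z → ∑-++ _ xs ys) zs) (∑-distrib-+ _ _ zs)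

  ⟪⟫-map : ∀ {h : U → U} → (∀ {x y} → h x ≡ h y → x ≡ y) →
           ∀ xs → ⟪ map h xs , map h xs ⟫ ≡ ⟪ xs , xs ⟫
  ⟪⟫-map inj xs = trans (∑-map _ _ xs) (∑-cong (count-map inj xs) xs)

  module _ (xs ys : List U) (x : U) where
    private
      -- A common coordinate set for both lists. The point `x` is adjoined so that its coordinate
      -- can be singled out even if it occurs in neither list.
      zs : List U
      zs = deduplicate _≟_ (x ∷ xs ++ ys)

      !zs : Unique zs
      !zs = Uniqueₚ.deduplicate-! _≟_ (x ∷ xs ++ ys)

      ⟪⟫-coords : ∀ vs ws → (∀ {v} → v ∈ˡ vs → v ∈ˡ x ∷ xs ++ ys) →
                  ⟪ vs , ws ⟫ ≡ ∑ (λ z → count vs z * count ws z) zs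
      ⟪⟫-coords vs ws vs⊆ = ∑-by-count {vs} (count ws) !zs (λ v∈ → ∈-deduplicate⁺ _≟_ (vs⊆ v∈))

      xs⊆ : ∀ {v} → v ∈ˡ xs → v ∈ˡ x ∷ xs ++ ys
      xs⊆ = there ∘ ∈-++⁺ˡ

      ys⊆ : ∀ {v} → v ∈ˡ ys → v ∈ˡ x ∷ xs ++ ys
      ys⊆ = there ∘ ∈-++⁺ʳ xs

      d : U → ℕ
      d z = count xs z ∸ count ys z

      pointwise : ∀ z → 2 * (count xs z * count ys z) + δ x z * (d z * d z) ≤
                        count xs z * count xs z + count ys z * count ys z
      pointwise z = ≤-trans (+-monoʳ-≤ (2 * (count xs z * count ys z)) (δ*≤ (x ≟ z)))
                            (2ab+[a∸b]²≤a²+b² (count xs z) (count ys z))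
        where
        δ*≤ : Dec (x ≡ z) → δ x z * (d z * d z) ≤ d z * d z
        δ*≤ (yes refl) rewrite δ-refl x = ≤-reflexive (+-identityʳ _)
        δ*≤ (no x≢z) rewrite δ-≢ x≢z = z≤n

    ⟪⟫-comm : ⟪ ys , xs ⟫ ≡ ⟪ xs , ys ⟫
    ⟪⟫-comm = trans (⟪⟫-coords ys xs ys⊆)
      (trans (∑-cong (λ z → *-comm (count ys z) (count xs z)) zs) (sym (⟪⟫-coords xs ys xs⊆)))

    2⟪⟫+d²≤ : 2 * ⟪ xs , ys ⟫ + d x * d x ≤ ⟪ xs , xs ⟫ + ⟪ ys , ys ⟫
    2⟪⟫+d²≤ = begin
      2 * ⟪ xs , ys ⟫ + d x * d x
        ≡⟨ cong₂ (λ p q → 2 * p + q) (⟪⟫-coords xs ys xs⊆)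
             (sym (∑-δ-∈ (λ z → d z * d z) !zs (∈-deduplicate⁺ _≟_ {x ∷ xs ++ ys} (here refl)))) ⟩
      2 * ∑ (λ z → count xs z * count ys z) zs + ∑ (λ z → δ x z * (d z * d z)) zs
        ≡⟨ cong (_+ ∑ δd² zs) (*-distribˡ-∑ 2 ⟨xy⟩ zs) ⟩
      ∑ (λ z → 2 * (count xs z * count ys z)) zs + ∑ (λ z → δ x z * (d z * d z)) zs
        ≡⟨ ∑-distrib-+ (λ z → 2 * ⟨xy⟩ z) δd² zs ⟨
      ∑ (λ z → 2 * (count xs z * count ys z) + δ x z * (d z * d z)) zs
        ≤⟨ ∑-mono zs (λ z _ → pointwise z) ⟩
      ∑ (λ z → count xs z * count xs z + count ys z * count ys z) zs
        ≡⟨ ∑-distrib-+ (λ z → count xs z * count xs z) (λ z → count ys z * count ys z) zs ⟩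
      ∑ (λ z → count xs z * count xs z) zs + ∑ (λ z → count ys z * count ys z) zs
        ≡⟨ cong₂ _+_ (⟪⟫-coords xs xs xs⊆) (⟪⟫-coords ys ys ys⊆) ⟨
      ⟪ xs , xs ⟫ + ⟪ ys , ys ⟫
        ∎
      where
      open ≤-Reasoning
      ⟨xy⟩ δd² : U → ℕ
      ⟨xy⟩ z = count xs z * count ys z
      δd² z = δ x z * (d z * d z)

    -- Parallelogram law, keeping one coordinate of the squared norm of the difference.
    ⟪⟫-parallelogram : ⟪ xs ++ ys , xs ++ ys ⟫ + d x * d x ≤ 2 * (⟪ xs , xs ⟫ + ⟪ ys , ys ⟫)
    ⟪⟫-parallelogram = begin
      ⟪ xs ++ ys , xs ++ ys ⟫ + d x * d x
        ≡⟨ cong (_+ d x * d x) (⟪⟫-++ xs ys) ⟩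
      ⟪ xs , xs ⟫ + ⟪ xs , ys ⟫ + (⟪ ys , xs ⟫ + ⟪ ys , ys ⟫) + d x * d x
        ≡⟨ cong (λ p → ⟪ xs , xs ⟫ + ⟪ xs , ys ⟫ + (p + ⟪ ys , ys ⟫) + d x * d x) ⟪⟫-comm ⟩
      ⟪ xs , xs ⟫ + ⟪ xs , ys ⟫ + (⟪ xs , ys ⟫ + ⟪ ys , ys ⟫) + d x * d x
        ≡⟨ rearrange ⟪ xs , xs ⟫ ⟪ xs , ys ⟫ ⟪ ys , ys ⟫ (d x * d x) ⟩
      (⟪ xs , xs ⟫ + ⟪ ys , ys ⟫) + (2 * ⟪ xs , ys ⟫ + d x * d x)
        ≤⟨ +-monoʳ-≤ (⟪ xs , xs ⟫ + ⟪ ys , ys ⟫) 2⟪⟫+d²≤ ⟩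
      (⟪ xs , xs ⟫ + ⟪ ys , ys ⟫) + (⟪ xs , xs ⟫ + ⟪ ys , ys ⟫)
        ≡⟨ twice (⟪ xs , xs ⟫ + ⟪ ys , ys ⟫) ⟩
      2 * (⟪ xs , xs ⟫ + ⟪ ys , ys ⟫)
        ∎
      where
      open ≤-Reasoning
      rearrange : ∀ p q r e → p + q + (q + r) + e ≡ (p + r) + (2 * q + e)
      rearrange = solve-∀
      twice : ∀ p → p + p ≡ 2 * p
      twice = solve-∀

-- Orbits of the action.

module Orbits (em : ∀ {a} → ExcludedMiddle a)
              {c ℓ u} (G : Group c ℓ) {U : Set u} (act : Action G U) where
  open Group G using (Carrier; _∙_; ε; _⁻¹; inverseˡ; inverseʳ)
  open Action act

  _≟ᵁ_ : DecidableEquality U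
  x ≟ᵁ y = em

  open Counting _≟ᵁ_

  ⁻¹-cancelˡ : ∀ g x → (g ⁻¹) · g · x ≡ x
  ⁻¹-cancelˡ g x = trans (sym (∙-act _ _ x)) (trans (·-cong (inverseˡ g) x) (ε-act x))

  ⁻¹-cancelʳ : ∀ g x → g · (g ⁻¹) · x ≡ x
  ⁻¹-cancelʳ g x = trans (sym (∙-act _ _ x)) (trans (·-cong (inverseʳ g) x) (ε-act x))

  ·-injective : ∀ g {x y} → g · x ≡ g · y → x ≡ y
  ·-injective g {x} {y} eq = trans (sym (⁻¹-cancelˡ g x)) (trans (cong ((g ⁻¹) ·_) eq) (⁻¹-cancelˡ g y))

  infix 4 _∼_ _∼?_

  _∼_ : U → U → Set (c ⊔ u)
  y ∼ x = ∃[ g ] y ≡ g · x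

  _∼?_ : ∀ y x → Dec (y ∼ x)
  y ∼? x = em

  ∼-refl : ∀ {x} → x ∼ x
  ∼-refl {x} = ε , sym (ε-act x)

  ∼-sym : ∀ {x y} → x ∼ y → y ∼ x
  ∼-sym {y = y} (g , refl) = g ⁻¹ , sym (⁻¹-cancelˡ g y)

  ∼-trans : ∀ {x y z} → x ∼ y → y ∼ z → x ∼ z
  ∼-trans {z = z} (g , refl) (h , refl) = g ∙ h , sym (∙-act g h z)

  -- Averages over lists of group elements and their energy.

  translates : List Carrier → U → List U
  translates S f = map (_· f) S

  length-translates : ∀ S f → length (translates S f) ≡ length S
  length-translates S f = length-map (_· f) S

  ∈-translates⁻ : ∀ S {f y} → y ∈ˡ translates S f → y ∼ f
  ∈-translates⁻ S y∈ with s , _ , y≡ ← ∈-map⁻ _ y∈ = s , y≡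

  -- The doubled list represents the average of a finitely supported measure on G and its g-translate.
  double : Carrier → List Carrier → List Carrier
  double g S = S ++ map (g ∙_) S

  length-double : ∀ g S → length (double g S) ≡ length S + length S
  length-double g S = trans (length-++ S) (cong (length S +_) (length-map (g ∙_) S))

  translates-double : ∀ g S f → translates (double g S) f ≡ translates S f ++ map (g ·_) (translates S f)
  translates-double g S f = trans (map-++ _ S _) (cong (translates S f ++_)
    (trans (sym (map-∘ S)) (trans (map-cong (λ s → ∙-act g s f) S) (map-∘ S))))

  -- Divided by (length S)², this is the squared ℓ²-norm of the distribution of s f for s uniform in
  -- `S`.
  energy : List Carrier → U → ℕ
  energy S f = ⟪ translates S f , translates S f ⟫

  -- Parallelogram law for the translates of `f` and their image under `g`, which have equal norm.
  -- The coordinate kept is `g · y`, where the image has multiplicity `v y`. The factor 4 matches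
  -- the growth of (length S)² under doubling.
  energy-double : ∀ g S f y → let v = count (translates S f) in
                  energy (double g S) f + (v (g · y) ∸ v y) * (v (g · y) ∸ v y) ≤ 4 * energy S f
  energy-double g S f y = begin
    energy (double g S) f + (v (g · y) ∸ v y) * (v (g · y) ∸ v y)
      ≡⟨ cong₂ (λ xs k → ⟪ xs , xs ⟫ + (v (g · y) ∸ k) * (v (g · y) ∸ k))
           (translates-double g S f) (sym (count-map (·-injective g) T y)) ⟩
    ⟪ T ++ gT , T ++ gT ⟫ + (v (g · y) ∸ count gT (g · y)) * (v (g · y) ∸ count gT (g · y))
      ≤⟨ ⟪⟫-parallelogram T gT (g · y) ⟩
    2 * (⟪ T , T ⟫ + ⟪ gT , gT ⟫)
      ≡⟨ cong (λ e → 2 * (⟪ T , T ⟫ + e)) (⟪⟫-map (·-injective g) T) ⟩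
    2 * (⟪ T , T ⟫ + ⟪ T , T ⟫)
      ≡⟨ four ⟪ T , T ⟫ ⟩
    4 * energy S f
      ∎
    where
    open ≤-Reasoning
    T  = translates S f
    gT = map (g ·_) T
    v  = count T
    four : ∀ e → 2 * (e + e) ≡ 4 * e
    four = solve-∀

  Φ : List U → List Carrier → ℕ
  Φ fs S = ∑ (energy S) fs

  Φ-double : ∀ fs S g y {f} → f ∈ˡ fs → let v = count (translates S f) in
             Φ fs (double g S) + (v (g · y) ∸ v y) * (v (g · y) ∸ v y) ≤ 4 * Φ fs S
  Φ-double fs S g y {f} f∈ = ≤-trans
    (∑-mono-gap fs f∈ (λ f′ → ≤-trans (m≤m+n _ _) (energy-double g S f′ y)) (energy-double g S f y))
    (≤-reflexive (sym (*-distribˡ-∑ 4 (energy S) fs)))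

  -- After division by K |S|: the probability of `g · y` exceeds that of `y` by at most 1 / K.
  -- Quantifying over all `g` makes the bound two-sided, since `g ⁻¹` takes `g · y` back to `y`.
  AlmostInvariant : ℕ → List U → List Carrier → Set (c ⊔ u)
  AlmostInvariant K fs S = ∀ f → f ∈ˡ fs → ∀ g y →
    K * count (translates S f) (g · y) ≤ K * count (translates S f) y + length S

  NotAlmostInvariant : ℕ → List U → List Carrier → Set (c ⊔ u)
  NotAlmostInvariant K fs S = ∃[ f ] (f ∈ˡ fs × ∃[ g ] ∃[ y ]
    K * count (translates S f) y + length S < K * count (translates S f) (g · y))

  -- Each failure of almost invariance lowers the normalised energy Φ / (length S)² by at least 1 / 4K².
  descent : ∀ K fs t S → 0 < length S → 4 * (K * K) * Φ fs S ≤ t * (length S * length S) →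
            ∃[ S′ ] (0 < length S′ × AlmostInvariant K fs S′)
  descent K fs t S 0<N bound with em {P = NotAlmostInvariant K fs S}
  ... | no ¬bad = S , 0<N , λ f f∈ g y → ≮⇒≥ (λ lt → ¬bad (f , f∈ , g , y , lt))
  ... | yes (f , f∈ , g , y , lt) = continue t decrease
    where
    open ≤-Reasoning
    N  = length S
    S′ = double g S
    N′ = length S′
    d  = count (translates S f) (g · y) ∸ count (translates S f) y

    N≤Kd : N ≤ K * d
    N≤Kd = begin
      N   ≤⟨ m+n≤o⇒m≤o∸n N (≤-trans (≤-reflexive (+-comm N _)) (<⇒≤ lt)) ⟩
      K * count (translates S f) (g · y) ∸ K * count (translates S f) y
          ≡⟨ *-distribˡ-∸ K _ _ ⟨
      K * d  ∎

    N′²≡4N² : N′ * N′ ≡ 4 * (N * N)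
    N′²≡4N² rewrite length-double g S = square N
      where
      square : ∀ n → (n + n) * (n + n) ≡ 4 * (n * n)
      square = solve-∀

    decrease : 4 * (K * K) * Φ fs S′ + N′ * N′ ≤ t * (N′ * N′)
    decrease = begin
      4 * (K * K) * Φ fs S′ + N′ * N′
        ≡⟨ cong (4 * (K * K) * Φ fs S′ +_) N′²≡4N² ⟩
      4 * (K * K) * Φ fs S′ + 4 * (N * N)
        ≤⟨ +-monoʳ-≤ (4 * (K * K) * Φ fs S′) (*-monoʳ-≤ 4 (*-mono-≤ N≤Kd N≤Kd)) ⟩
      4 * (K * K) * Φ fs S′ + 4 * (K * d * (K * d))
        ≡⟨ factor K (Φ fs S′) d ⟩
      4 * (K * K) * (Φ fs S′ + d * d)
        ≤⟨ *-monoʳ-≤ (4 * (K * K)) (Φ-double fs S g y f∈) ⟩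
      4 * (K * K) * (4 * Φ fs S)
        ≡⟨ swap (4 * (K * K)) (Φ fs S) ⟩
      4 * (4 * (K * K) * Φ fs S)
        ≤⟨ *-monoʳ-≤ 4 bound ⟩
      4 * (t * (N * N))
        ≡⟨ swap t (N * N) ⟨
      t * (4 * (N * N))
        ≡⟨ cong (t *_) N′²≡4N² ⟨
      t * (N′ * N′)
        ∎
      where
      factor : ∀ k p e → 4 * (k * k) * p + 4 * (k * e * (k * e)) ≡ 4 * (k * k) * (p + e * e)
      factor = solve-∀
      swap : ∀ p q → p * (4 * q) ≡ 4 * (p * q)
      swap = solve-∀

    0<N′ : 0 < N′
    0<N′ rewrite length-double g S = ≤-trans 0<N (m≤m+n N N)

    -- The number `t` bounds the normalised energy in units of 1 / 4K², so each doubling uses up one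
    -- unit. At `t` zero a further drop is impossible, as N′² would have to vanish.
    continue : ∀ t → 4 * (K * K) * Φ fs S′ + N′ * N′ ≤ t * (N′ * N′) →
               ∃[ S″ ] (0 < length S″ × AlmostInvariant K fs S″)
    continue zero    le = ⊥-elim (<-irrefl refl (<-≤-trans (*-mono-≤ 0<N′ 0<N′) (m+n≤o⇒n≤o _ le)))
    continue (suc t) le = descent K fs t S′ 0<N′
      (+-cancelʳ-≤ (N′ * N′) _ _ (≤-trans le (≤-reflexive (+-comm (N′ * N′) _))))

  almostInvariant : ∀ K fs → ∃[ S ] (0 < length S × AlmostInvariant K fs S)
  -- The starting list has length 1, so this budget meets the required bound with equality.
  almostInvariant K fs = descent K fs (4 * (K * K) * Φ fs (ε ∷ [])) (ε ∷ []) (s≤s z≤n)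
    (≤-reflexive (sym (*-identityʳ _)))

  -- Enumerating finite orbits.

  Enumerates : List U → U → Set (c ⊔ u)
  Enumerates L x = ∀ y → y ∈ˡ L ⇔ y ∼ x

  -- Orbit points are collected one at a time until none is missing or `suc b` distinct ones are
  -- found. Infinite orbits thus need no separate treatment: b + 1 of their points suffice for the
  -- averaging.
  enumerate-or-exceed : ∀ x b → (∃[ L ] (Enumerates L x × length L ≤ b)) ⊎
                                (∃[ L ] (Unique L × (∀ y → y ∈ˡ L → y ∼ x) × length L ≡ suc b))
  enumerate-or-exceed x b = start (suc b) ≤-refl
    where
    Small Large : ℕ → Set _
    Small b = ∃[ L ] (Enumerates L x × length L ≤ b)
    Large b = ∃[ L ] (Unique L × (∀ y → y ∈ˡ L → y ∼ x) × length L ≡ b)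

    grow : ∀ b′ L → Unique L → (∀ y → y ∈ˡ L → y ∼ x) → length L ≡ b′ → b′ ≤ b → Small b ⊎ Large (suc b′)
    grow b′ L !L L⊆ refl b′≤b with em {P = ∃[ y ] (y ∼ x × y ∉ˡ L)}
    ... | yes (y , y∼x , y∉) = inj₂ (y ∷ L , ¬Any⇒All¬ L y∉ ∷ !L , L′⊆ , refl)
      where
      L′⊆ : ∀ z → z ∈ˡ y ∷ L → z ∼ x
      L′⊆ z (here refl) = y∼x
      L′⊆ z (there z∈)  = L⊆ z z∈
    ... | no ¬new = inj₁ (L , (λ y → mk⇔ (L⊆ y) (complete y)) , b′≤b)
      where
      complete : ∀ y → y ∼ x → y ∈ˡ L
      complete y y∼x with Any.any? (y ≟ᵁ_) L
      ... | yes y∈ = y∈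
      ... | no y∉  = contradiction (y , y∼x , y∉) ¬new

    start : ∀ k → k ≤ suc b → Small b ⊎ Large k
    start zero    _   = inj₂ ([] , [] , (λ _ ()) , refl)
    start (suc k) (s≤s k≤b) =
      [ inj₁ , (λ (L , !L , L⊆ , len) → grow k L !L L⊆ len k≤b) ]′ (start k (m≤n⇒m≤1+n k≤b))

  -- Orbits of size at most m times their share of X.

  orbitIn : List U → U → List U
  orbitIn xs x = filter (_∼? x) xs

  -- The condition |O| ≤ m |X ∩ O| for the orbit O of `x`; the list `L` makes finiteness of O part
  -- of it.
  SmallOrbit : ℕ → List U → U → Set (c ⊔ u)
  SmallOrbit m xs x = ∃[ L ] (Enumerates L x × length L ≤ m * length (orbitIn xs x))

  -- Double counting: each `s` in `S` moves some `f` into `xs` and so contributes at least 1.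
  -- Exchanging the sums sorts these hits by `f`.
  total-hits : ∀ S fs xs → (∀ g → ∃[ f ] (f ∈ˡ fs × g · f ∈ˡ xs)) →
               length S ≤ ∑ (λ f → ∑ (count (translates S f)) xs) fs
  total-hits S fs xs hit = begin
    length S
      ≡⟨ *-identityʳ (length S) ⟨
    length S * 1
      ≡⟨ ∑-const 1 S ⟨
    ∑ (λ s → 1) S
      ≤⟨ ∑-mono S (λ s _ → hit-by s (hit s)) ⟩
    ∑ (λ s → ∑ (λ f → ∑ (δ (s · f)) xs) fs) S
      ≡⟨ ∑-swap (λ s f → ∑ (δ (s · f)) xs) S fs ⟩
    ∑ (λ f → ∑ (λ s → ∑ (δ (s · f)) xs) S) fs
      ≡⟨ ∑-cong (λ f → trans (sym (∑-map (λ y → ∑ (δ y) xs) (_· f) S))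
                             (∑-swap δ (translates S f) xs)) fs ⟩
    ∑ (λ f → ∑ (count (translates S f)) xs) fs
      ∎
    where
    open ≤-Reasoning
    hit-by : ∀ s → ∃[ f ] (f ∈ˡ fs × s · f ∈ˡ xs) → 1 ≤ ∑ (λ f → ∑ (δ (s · f)) xs) fs
    hit-by s (f , f∈ , sf∈) = begin
      1                                 ≡⟨ δ-refl (s · f) ⟨
      δ (s · f) (s · f)                 ≤⟨ ∈⇒≤∑ (δ (s · f)) sf∈ ⟩
      ∑ (δ (s · f)) xs                  ≤⟨ ∈⇒≤∑ (λ f → ∑ (δ (s · f)) xs) f∈ ⟩
      ∑ (λ f → ∑ (δ (s · f)) xs) fs     ∎

  -- Each count on the orbit is compared with the mean count over L, which is at most length S / length L.
  count-bound : ∀ K S f xs L → (∀ g y → K * count (translates S f) (g · y) ≤ K * count (translates S f) y + length S) →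
                Unique L → (∀ y → y ∈ˡ L → y ∼ f) →
                length L * (K * ∑ (count (translates S f)) xs) ≤
                length (orbitIn xs f) * (K * length S + length L * length S)
  count-bound K S f xs L inv !L L⊆ = begin
    M * (K * ∑ v xs)
      -- Translates of `f` stay in its orbit, so the other entries of `xs` have count zero.
      ≡⟨ cong (λ e → M * (K * e)) (∑-filter (_∼? f) xs (λ x x≁f → count-∉ (x≁f ∘ ∈-translates⁻ S))) ⟨
    M * (K * ∑ v xf)
      ≡⟨ *-assoc M K _ ⟨
    M * K * ∑ v xf
      ≡⟨ *-distribˡ-∑ (M * K) v xf ⟩
    ∑ (λ x → M * K * v x) xf
      ≤⟨ ∑≤length*max xf (λ x x∈ → at x (proj₂ (∈-filter⁻ (_∼? f) {xs = xs} x∈))) ⟩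
    length xf * (K * N + M * N)
      ∎
    where
    open ≤-Reasoning
    M  = length L
    N  = length S
    v  = count (translates S f)
    xf = orbitIn xs f

    compare : ∀ x → x ∼ f → ∀ y → y ∈ˡ L → K * v x ≤ K * v y + N
    compare x x∼f y y∈ with g , refl ← ∼-trans x∼f (∼-sym (L⊆ y y∈)) = inv g y

    at : ∀ x → x ∼ f → M * K * v x ≤ K * N + M * N
    at x x∼f = begin
      M * K * v x                         ≡⟨ *-assoc M K (v x) ⟩
      M * (K * v x)                       ≡⟨ ∑-const (K * v x) L ⟨
      ∑ (λ _ → K * v x) L                 ≤⟨ ∑-mono L (compare x x∼f) ⟩
      ∑ (λ y → K * v y + N) L             ≡⟨ ∑-distrib-+ (λ y → K * v y) (λ _ → N) L ⟩
      ∑ (λ y → K * v y) L + ∑ (λ _ → N) L ≡⟨ cong₂ _+_ (sym (*-distribˡ-∑ K v L)) (∑-const N L) ⟩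
      K * ∑ v L + M * N                   ≤⟨ +-monoˡ-≤ (M * N) (*-monoʳ-≤ K (∑-count≤length (translates S f) !L)) ⟩
      K * length (translates S f) + M * N ≡⟨ cong (λ e → K * e + M * N) (length-translates S f) ⟩
      K * N + M * N                       ∎

  -- Some `f` receives at least the share 1 / m of the hits. If its orbit had M = b + 1 distinct
  -- points with b = m |X ∩ O|, exact invariance would force M ≤ b; the error left by almost
  -- invariance is too small to avoid this contradiction.
  meets-small-orbit : ∀ m xs fs → length fs ≤ m → (∀ g → ∃[ f ] (f ∈ˡ fs × g · f ∈ˡ xs)) →
                      ∃[ f ] (f ∈ˡ fs × SmallOrbit m xs f)
  meets-small-orbit m xs fs len≤m hit = from-invariant (almostInvariant K fs)
    where
    open ≤-Reasoning
    b₀ = m * length xs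
    -- `K` must be fixed before `S`, hence before `f` is known. So it exceeds b (b + 1) for the
    -- largest value `b₀` that b can take.
    K  = suc (b₀ * suc b₀)

    from-invariant : ∃[ S ] (0 < length S × AlmostInvariant K fs S) → ∃[ f ] (f ∈ˡ fs × SmallOrbit m xs f)
    from-invariant (S , 0<N , inv) =
      often-hit (pigeonhole (λ f → ∑ (count (translates S f)) xs) N m fs 0<N len≤m (total-hits S fs xs hit))
      where
      N = length S

      often-hit : ∃[ f ] (f ∈ˡ fs × N ≤ m * ∑ (count (translates S f)) xs) → ∃[ f ] (f ∈ˡ fs × SmallOrbit m xs f)
      often-hit (f , f∈ , N≤) with enumerate-or-exceed f (m * length (orbitIn xs f))
      ... | inj₁ small = f , f∈ , small
      ... | inj₂ (L , !L , L⊆ , len) = ⊥-elim (<-irrefl refl (begin-strict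
        b₀ * suc b₀    <⟨ n<1+n _ ⟩
        K              ≤⟨ K≤b*1+b ⟩
        b * suc b      ≤⟨ *-mono-≤ b≤b₀ (s≤s b≤b₀) ⟩
        b₀ * suc b₀    ∎))
        where
        b = m * length (orbitIn xs f)
        v = count (translates S f)

        b≤b₀ : b ≤ b₀
        b≤b₀ = *-monoʳ-≤ m (length-filter (_∼? f) xs)

        scaled : suc b * (K * N) ≤ b * (K * N + suc b * N)
        scaled = begin
          suc b * (K * N)                     ≤⟨ *-monoʳ-≤ (suc b) (*-monoʳ-≤ K N≤) ⟩
          suc b * (K * (m * ∑ v xs))          ≡⟨ pull (suc b) K m (∑ v xs) ⟩
          m * (suc b * (K * ∑ v xs))          ≡⟨ cong (λ M → m * (M * (K * ∑ v xs))) len ⟨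
          m * (length L * (K * ∑ v xs))       ≤⟨ *-monoʳ-≤ m (count-bound K S f xs L (inv f f∈) !L L⊆) ⟩
          m * (length (orbitIn xs f) * (K * N + length L * N))
                                              ≡⟨ *-assoc m _ _ ⟨
          b * (K * N + length L * N)          ≡⟨ cong (λ M → b * (K * N + M * N)) len ⟩
          b * (K * N + suc b * N)             ∎
          where
          pull : ∀ p q r s → p * (q * (r * s)) ≡ r * (p * (q * s))
          pull = solve-∀

        -- As M = b + 1, cancelling b K N in `scaled` leaves K N on the left and only the error term
        -- b M N on the right.
        K≤b*1+b : K ≤ b * suc b
        K≤b*1+b = *-cancelʳ-≤ K (b * suc b) N {{>-nonZero 0<N}} (+-cancelʳ-≤ (b * (K * N)) _ _ (begin
          K * N + b * (K * N)                 ≤⟨ scaled ⟩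
          b * (K * N + suc b * N)             ≡⟨ expand b (K * N) (suc b) N ⟩
          b * suc b * N + b * (K * N)         ∎))
          where
          expand : ∀ p q r s → p * (q + r * s) ≡ p * r * s + p * q
          expand = solve-∀

  -- The union of the small orbits.

  orbitIn-remove : ∀ {x y} xs → ¬ y ∼ x → orbitIn (filter (λ z → ¬? (z ∼? x)) xs) y ≡ orbitIn xs y
  orbitIn-remove []       y≁x = refl
  orbitIn-remove {x} {y} (z ∷ xs) y≁x with z ∼? x
  -- The removed `z` lies in the orbit of `x`, hence not in that of `y`.
  ... | yes z∼x = trans (orbitIn-remove xs y≁x)
                        (sym (filter-reject (_∼? y) (λ z∼y → y≁x (∼-trans (∼-sym z∼y) z∼x))))
  ... | no _ with z ∼? y
  ...   | yes _ = cong (z ∷_) (orbitIn-remove xs y≁x)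
  ...   | no _  = orbitIn-remove xs y≁x

  length-split : ∀ {p} {P : Pred U p} (P? : ∀ x → Dec (P x)) xs →
                 length (filter P? xs) + length (filter (λ z → ¬? (P? z)) xs) ≡ length xs
  length-split P? []       = refl
  length-split P? (x ∷ xs) with P? x
  ... | yes _ = cong suc (length-split P? xs)
  ... | no _  = trans (+-suc _ _) (cong suc (length-split P? xs))

  SmallOrbitUnion : ℕ → List U → Set (c ⊔ u)
  SmallOrbitUnion m xs = ∃[ ys ] ((∀ g y → y ∈ˡ ys → g · y ∈ˡ ys) ×
                                  (∀ y → SmallOrbit m xs y → y ∈ˡ ys) ×
                                  length ys ≤ m * length xs)

  -- Treats the orbit of the first entry and recurses on the entries outside it; `n` bounds the
  -- length, since that remainder is not a structural sublist. Each orbit used is paid for by the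
  -- entries of `xs` lying in it, so no entry is charged twice.
  smallOrbitUnion : ∀ m n xs → length xs ≤ n → SmallOrbitUnion m xs
  smallOrbitUnion m n [] _ = [] , (λ _ _ ()) , no-small , z≤n
    where
    -- An orbit contains its own point, while the bound for an empty list is m · 0.
    no-small : ∀ y → SmallOrbit m [] y → y ∈ˡ []
    no-small y (L , enum , len) with L | Equivalence.from (enum y) ∼-refl
    ... | _ ∷ _ | _ = contradiction (≤-trans len (≤-reflexive (*-zeroʳ m))) λ ()
  smallOrbitUnion m (suc n) (x ∷ xs) (s≤s len≤n) = extend (em {P = SmallOrbit m (x ∷ xs) x})
    where
    open ≤-Reasoning
    rest = filter (λ z → ¬? (z ∼? x)) (x ∷ xs)

    rest≤ : length rest ≤ n
    rest≤ rewrite filter-reject (λ z → ¬? (z ∼? x)) {x} {xs} (λ x≁x → x≁x ∼-refl) =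
      ≤-trans (length-filter _ xs) len≤n

    recurse : SmallOrbitUnion m rest
    recurse = smallOrbitUnion m n rest rest≤

    small-in-rest : ∀ {y} → ¬ y ∼ x → SmallOrbit m (x ∷ xs) y → SmallOrbit m rest y
    small-in-rest y≁x (L , enum , len) =
      L , enum , subst (λ zs → length L ≤ m * length zs) (sym (orbitIn-remove (x ∷ xs) y≁x)) len

    extend : Dec (SmallOrbit m (x ∷ xs) x) → SmallOrbitUnion m (x ∷ xs)
    extend d with ys , closed , covers , len ← recurse | d
    ... | no ¬small = ys , closed , covers′ , ≤-trans len (*-monoʳ-≤ m (length-filter (λ z → ¬? (z ∼? x)) (x ∷ xs)))
      where
      covers′ : ∀ y → SmallOrbit m (x ∷ xs) y → y ∈ˡ ys
      covers′ y small with y ∼? x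
      ... | no y≁x  = covers y (small-in-rest y≁x small)
      ... | yes y∼x = contradiction (transport small) ¬small
        where
        -- Smallness depends only on the orbit, not on the point chosen in it.
        transport : SmallOrbit m (x ∷ xs) y → SmallOrbit m (x ∷ xs) x
        transport (L , enum , len) =
          L , (λ z → mk⇔ (λ z∈ → ∼-trans (Equivalence.to (enum z) z∈) y∼x)
                         (λ z∼x → Equivalence.from (enum z) (∼-trans z∼x (∼-sym y∼x))))
            , subst (λ zs → length L ≤ m * length zs)
                (filter-≐ (_∼? y) (_∼? x) ((λ z∼y → ∼-trans z∼y y∼x) , (λ z∼x → ∼-trans z∼x (∼-sym y∼x))) (x ∷ xs)) len
    ... | yes (L , enum , lenL) = L ++ ys , closed′ , covers′ , len′
      where
      closed′ : ∀ g y → y ∈ˡ L ++ ys → g · y ∈ˡ L ++ ys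
      closed′ g y y∈ with ∈-++⁻ L y∈
      ... | inj₁ y∈L  = ∈-++⁺ˡ (Equivalence.from (enum _) (∼-trans (g , refl) (Equivalence.to (enum y) y∈L)))
      ... | inj₂ y∈ys = ∈-++⁺ʳ L (closed g y y∈ys)

      covers′ : ∀ y → SmallOrbit m (x ∷ xs) y → y ∈ˡ L ++ ys
      covers′ y small with y ∼? x
      ... | yes y∼x = ∈-++⁺ˡ (Equivalence.from (enum y) y∼x)
      ... | no y≁x  = ∈-++⁺ʳ L (covers y (small-in-rest y≁x small))

      len′ : length (L ++ ys) ≤ m * length (x ∷ xs)
      len′ = begin
        length (L ++ ys)                                      ≡⟨ length-++ L ⟩
        length L + length ys                                  ≤⟨ +-mono-≤ lenL len ⟩
        m * length (orbitIn (x ∷ xs) x) + m * length rest     ≡⟨ *-distribˡ-+ m _ _ ⟨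
        m * (length (orbitIn (x ∷ xs) x) + length rest)       ≡⟨ cong (m *_) (length-split (_∼? x) (x ∷ xs)) ⟩
        m * length (x ∷ xs)                                   ∎

mainTheorem1 : (∀ {a} → ExcludedMiddle a) →
    ∀ {c ℓ u f : Level} (G : Group c ℓ) (U : Set u) (A : Action G U) →
    let open Action A in
    (𝓕 : Pred (Pred U u) f) → IsFamily 𝓕 → InvariantFamily 𝓕 →
    (∀ F → F ∈ 𝓕 → Finite F) →
    (m : ℕ) → IsMaxCard 𝓕 m →
    (X : Pred U u) (n : ℕ) → HasCard X n → IsSystemOfRepresentatives 𝓕 X →
    ∃[ Y ] (InvariantSubset Y × IsSystemOfRepresentatives 𝓕 Y ×
    (∃[ k ] (HasCard Y k × k ≤ n * m)))
mainTheorem1 em G U A 𝓕 _ 𝓕-inv 𝓕-fin m (card≤m , _) X n (xs , _ , refl , X⇔xs) X-rep =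
  conclude (smallOrbitUnion m n xs ≤-refl)
  where
  open Action A
  open Group G using (_⁻¹)
  open Orbits em G A

  conclude : SmallOrbitUnion m xs →
             ∃[ Y ] (InvariantSubset Y × IsSystemOfRepresentatives 𝓕 Y × (∃[ k ] (HasCard Y k × k ≤ n * m)))
  conclude (ys , closed , covers , len) =
    (_∈ˡ ys) , (λ g → (λ { (y , y∈ , refl) → closed g y y∈ })
                    -- Closure under `g ⁻¹` gives the reverse inclusion, as y = g (g⁻¹ y).
                    , (λ {y} y∈ → (g ⁻¹) · y , closed (g ⁻¹) y y∈ , sym (⁻¹-cancelʳ g y)))
             , (λ F F∈ → Y-meets F F∈ (𝓕-fin F F∈))
             , length ys′
             , (ys′ , Uniqueₚ.deduplicate-! _≟ᵁ_ ys , refl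
                    , (λ y → mk⇔ (∈-deduplicate⁺ _≟ᵁ_) (∈-deduplicate⁻ _≟ᵁ_ ys)))
             , ≤-trans (length-deduplicate _≟ᵁ_ ys) (≤-trans len (≤-reflexive (*-comm m n)))
    where
    ys′ : List U
    -- `HasCard` counts by a list without repetitions; removing them can only shorten `ys`.
    ys′ = deduplicate _≟ᵁ_ ys

    -- By invariance of the family X also meets gF, and the common point is g y for some y in F.
    meets-translates : ∀ F → F ∈ 𝓕 → ∀ {fs} → (∀ y → y ∈ F ⇔ y ∈ˡ fs) → ∀ g → ∃[ y ] (y ∈ˡ fs × g · y ∈ˡ xs)
    meets-translates F F∈ F⇔fs g with x , x∈X , y , y∈F , refl ← X-rep (g ·ˢ F) (𝓕-inv g F F∈) =
      y , Equivalence.to (F⇔fs y) y∈F , Equivalence.to (X⇔xs _) x∈X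

    Y-meets : ∀ F → F ∈ 𝓕 → Finite F → (_∈ˡ ys) ≬ F
    Y-meets F F∈ (k , fs , !fs , refl , F⇔fs) =
      let y , y∈ , small = meets-small-orbit m xs fs (card≤m F k F∈ (fs , !fs , refl , F⇔fs))
                             (meets-translates F F∈ F⇔fs)
      in y , covers y small , Equivalence.from (F⇔fs y) y∈
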